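{- Let $A$, $B$, $C$ be well-founded binary relations on a set $V$. Suppose that $$CB \;\subseteq\; B\,(B\cup C)^* \,\cup\, C$$ and $$(B\cup C)\,A \;\subseteq\; A\,(A\cup B\cup C)^* \,\cup\, B \,\cup\, C .$$ Then the union $A\cup B\cup C$ is well-founded.
   Context: A binary relation $R$ on $V$ is called well-founded if there is no infinite forward-pointing path, i.e. no infinite sequence $x_0,x_1,x_2,\dots$ of (not necessarily distinct) elements of $V$ with $x_i \mathrel{R} x_{i+1}$ for all $i\ge 0$. Juxtaposition denotes composition of relations read from left to right: $x \mathrel{(RS)} z$ iff there is $y\in V$ with $x\mathrel{R}y$ and $y\mathrel{S}z$. $R^*$ denotes the reflexive-transitive closure of $R$ (zero or more $R$-steps). Composition binds more tightly than union. -}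

module Defs where

open import Data.Nat.Base using (ℕ; suc)
open import Data.Product.Base using (Σ)
open import Level using (Level; _⊔_)
-- The name being renamed contains U+037E (Greek question mark), not a semicolon.
open import Relation.Binary.Construct.Composition public
  using () renaming (_;_ to infixr 9 _⨾_)
open import Relation.Binary.Core using (Rel)
open import Relation.Nullary.Negation.Core using (¬_)

private
  variable
    a ℓ : Level
    V : Set a

ForwardPath : Rel V ℓ → (ℕ → V) → Set ℓ
ForwardPath R x = ∀ i → R (x i) (x (suc i))

-- Paths go forward along R, so this corresponds (classically) to the
-- accessibility-based Induction.WellFounded.WellFounded of the converse of R.
PathWellFounded : {V : Set a} → Rel V ℓ → Set (a ⊔ ℓ)
PathWellFounded {V = V} R = ¬ Σ (ℕ → V) (ForwardPath R)

{-# OPTIONS --safe #-}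

-- Say that A jumps over B when B A ⊆ A (A ∪ B)* ∪ B. Then A ∪ B inherits
-- well-foundedness from A and B: suppose that every A-successor of x
-- terminates. Following x B y A z, either z lies below an A-successor of x and
-- so terminates, or x B z. Hence, by A-induction, all B-successors of x have
-- only terminating A-successors, and B-induction shows that x terminates.
-- The theorem is this principle applied to B over C and then to A over B ∪ C.
module Submission where

open import Defs
open import Axiom.ExcludedMiddle using (ExcludedMiddle)
open import Data.Nat.Base using (ℕ; zero; suc)
open import Data.Product.Base using (∃; _×_; _,_; proj₁; proj₂)
open import Data.Sum.Base using (inj₁; inj₂)
open import Function.Base using (flip; _∘_)
open import Induction.WellFounded using (Acc; acc; WellFounded)
open import Level using (Level; _⊔_)
open import Relation.Binary.Core using (Rel; _⇒_)
open import Relation.Binary.Construct.Closure.ReflexiveTransitive using (Star; ε; _◅_)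
open import Relation.Binary.Construct.Union using (_∪_)
open import Relation.Nullary.Decidable using (decidable-stable)
open import Relation.Nullary.Negation.Core using (¬_)

private
  variable
    a ℓ : Level
    V : Set a

acc⇒noPath : {R : Rel V ℓ} (x : ℕ → V) → Acc (flip R) (x 0) → ¬ ForwardPath R x
acc⇒noPath x (acc rs) path = acc⇒noPath (x ∘ suc) (rs (path 0)) (path ∘ suc)

wellFounded⇒pathWellFounded : {R : Rel V ℓ} → WellFounded (flip R) → PathWellFounded R
wellFounded⇒pathWellFounded wf (x , path) = acc⇒noPath x (wf (x 0)) path

-- Excluded middle here decides arbitrary types, not only propositions, so it
-- also supplies the choice of successors from which the path is built.
pathWellFounded⇒wellFounded : ExcludedMiddle (a ⊔ ℓ) → {V : Set a} {R : Rel V ℓ} →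
  PathWellFounded R → WellFounded (flip R)
pathWellFounded⇒wellFounded em {V} {R} pwf v = decidable-stable em λ ¬acc →
  -- The point at `suc i` is by definition the one `step` picks at `i`, so the edge returned by
  -- `step` fits.
  pwf (proj₁ ∘ path (v , ¬acc) , λ i → proj₁ (proj₂ (step (path (v , ¬acc) i))))
  where
  NonTerminating : Set _
  NonTerminating = ∃ λ x → ¬ Acc (flip R) x

  step : ((x , _) : NonTerminating) → ∃ λ y → R x y × ¬ Acc (flip R) y
  step (x , ¬acc) = decidable-stable em λ ¬succ →
    ¬acc (acc λ {y} xRy → decidable-stable em λ ¬accʸ → ¬succ (y , xRy , ¬accʸ))

  path : NonTerminating → ℕ → NonTerminating
  path s zero    = s
  path s (suc i) = let y , _ , ¬acc = step (path s i) in y , ¬acc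

acc-star : {R : Rel V ℓ} → ∀ {x y} → Acc (flip R) x → Star R x y → Acc (flip R) y
acc-star ac       ε         = ac
acc-star (acc rs) (r ◅ rs*) = acc-star (rs r) rs*

module _ {V : Set a} {A B : Rel V ℓ}
  (wfA : WellFounded (flip A)) (wfB : WellFounded (flip B))
  (jump : (B ⨾ A) ⇒ ((A ⨾ Star (A ∪ B)) ∪ B)) where

  private
    Terminates : V → Set _
    Terminates = Acc (flip (A ∪ B))

    -- Lexicographic induction: the outer descends along `B` from `x`; the inner, with `x` fixed,
    -- descends along `A` through the `B`-successors of `x`.
    terminates-B : ∀ {x} → Acc (flip B) x →
      (∀ {y} → A x y → Terminates y) → Terminates x
    terminates-B {x} (acc rsB) succA = acc λ
      { (inj₁ xAy) → succA xAy
      ; (inj₂ xBy) → B-succ (wfA _) xBy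
      }
      where
      B-succ : ∀ {y} → Acc (flip A) y → B x y → Terminates y
      A-succ : ∀ {y z} → Acc (flip A) z → B x y → A y z → Terminates z

      B-succ (acc rsA) xBy = terminates-B (rsB xBy) λ yAz → A-succ (rsA yAz) xBy yAz

      A-succ accᶻ xBy yAz with jump (_ , xBy , yAz)
      ... | inj₁ (_ , xAw , w⟶*z) = acc-star (succA xAw) w⟶*z
      -- Now `z` replaces `y` as a `B`-successor of the same `x`, with a smaller `A`-accessibility
      -- proof.
      ... | inj₂ xBz              = B-succ accᶻ xBz

    terminates-A : ∀ {x} → Acc (flip A) x → Terminates x
    terminates-A (acc rsA) = terminates-B (wfB _) λ xAy → terminates-A (rsA xAy)

  jumping⇒wellFounded : WellFounded (flip (A ∪ B))
  jumping⇒wellFounded x = terminates-A (wfA x)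

theorem5 : ∀ {a ℓ : Level} → ExcludedMiddle (a ⊔ ℓ) →
    {V : Set a} (A B C : Rel V ℓ) →
    PathWellFounded A → PathWellFounded B → PathWellFounded C →
    (C ⨾ B) ⇒ ((B ⨾ Star (B ∪ C)) ∪ C) →
    ((B ∪ C) ⨾ A) ⇒ ((A ⨾ Star (A ∪ B ∪ C)) ∪ B ∪ C) →
    PathWellFounded (A ∪ B ∪ C)
theorem5 em A B C pwfA pwfB pwfC CB⇒ BC-A⇒ =
  wellFounded⇒pathWellFounded
    -- Since the union associates to the right, `BC-A⇒` is literally the jump condition of `A` over
    -- `B ∪ C`.
    (jumping⇒wellFounded (wf pwfA) (jumping⇒wellFounded (wf pwfB) (wf pwfC) CB⇒) BC-A⇒)
  where
  wf : ∀ {R} → PathWellFounded R → WellFounded (flip R)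
  wf = pathWellFounded⇒wellFounded em
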